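{- The ordinary generating function $A(x,y;p,1)=\sum_{n\ge1}a_n(y;p,1)x^n$ is given by $$A(x,y;p,1)=xyp+\frac{x^2yp(1-p)}{1-yp}\left(\sum_{j\ge0}\frac{(-1)^jx^jp^{j+\binom{j+2}{2}}}{\prod_{i=0}^{j}(1-p-xp^{i+1})}-y^2p^2\sum_{j\ge0}\frac{(-1)^jx^jy^jp^{2j+\binom{j+2}{2}}}{\prod_{i=0}^{j}(1-p-xyp^{i+2})}\right).$$
   Context: An inversion sequence of length $n$ is a sequence $\rho=\rho_1\cdots\rho_n$ of integers with $1\le \rho_i\le i$ for all $i$; $I_{n,i}$ is the set of those of length $n$ with last letter $i$. Let $\mathrm{area}(\rho)=\rho_1+\cdots+\rho_n$ and $\mathrm{sper}(\rho)=n+\rho_1+\sum_{i=1}^{n-1}\max(\rho_{i+1}-\rho_i,0)$ (area and semi-perimeter of the associated bargraph). Define $a_n(y;p,q)=\sum_{i=1}^n y^i\sum_{\rho\in I_{n,i}}p^{\mathrm{area}(\rho)}q^{\mathrm{sper}(\rho)}$. The identity is one of power series in $x$ (with coefficients rational functions of $p,y$; e.g. valid for $|x|,|p|<1$ small enough). -}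

module Defs where

open import Algebra.Bundles using (CommutativeRing)
open import Algebra.Bundles.Raw using (RawSemiring)
open import Data.Fin.Base using (Fin; zero; suc; toℕ; fromℕ; inject₁)
open import Data.Fin.Properties using (toℕ-fromℕ; toℕ-inject₁)
open import Data.Fin.Relation.Unary.Top using (view; ‵fromℕ; ‵inject₁)
open import Data.List.Base as List using (List; []; _∷_; filter; foldr; upTo; cartesianProductWith)
open import Data.List.Membership.Propositional using (_∈_)
open import Data.List.Membership.Propositional.Properties using (∈-cartesianProductWith⁺; ∈-cartesianProductWith⁻; ∈-map⁺; ∈-map⁻; ∈-upTo⁺; ∈-upTo⁻)
open import Data.List.Relation.Unary.Any using (here)
open import Data.List.Relation.Unary.All using ([])
open import Data.List.Relation.Unary.AllPairs using ([]; _∷_)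
open import Data.List.Relation.Unary.Unique.Propositional using (Unique)
import Data.List.Relation.Unary.Unique.Propositional.Properties as Uniqueₚ
open import Data.Nat.Base as ℕ using (ℕ; zero; suc; _∸_; _≤_; _<_; z≤n; s≤s)
open import Data.Nat.Properties as ℕₚ using (_≟_)
open import Data.Product.Base using (_×_; _,_)
open import Data.Vec.Base as Vec using (Vec; []; _∷_; _∷ʳ_; lookup; last; initLast)
open import Data.Vec.Properties using (∷ʳ-injective)
open import Function.Bundles using (_⇔_; mk⇔)
open import Relation.Binary.PropositionalEquality as ≡ using (_≡_; refl)

------------------------------------------------------------------------
-- Inversion sequences

-- The index k : Fin n is 0-based, so it stands for the position i = suc (toℕ k).
IsInversionSequence : ∀ {n} → Vec ℕ n → Set
IsInversionSequence {n} ρ = ∀ (k : Fin n) → 1 ≤ lookup ρ k × lookup ρ k ≤ suc (toℕ k)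

-- Every inversion sequence of length n, exactly once: see
-- ∈-inversionSequences and inversionSequences-unique below.
inversionSequences : ∀ n → List (Vec ℕ n)
inversionSequences zero    = [] ∷ []
inversionSequences (suc n) =
  cartesianProductWith _∷ʳ_ (inversionSequences n) (List.map suc (upTo (suc n)))

I : ∀ n → ℕ → List (Vec ℕ n)
I zero    i = []
I (suc n) i = filter (λ ρ → last ρ ≟ i) (inversionSequences (suc n))

area : ∀ {n} → Vec ℕ n → ℕ
area = Vec.sum

-- Truncated subtraction is max(ρᵢ₊₁ − ρᵢ, 0).
ascents : ∀ {n} → Vec ℕ n → ℕ
ascents []           = 0
ascents (_ ∷ [])     = 0
ascents (r ∷ s ∷ ρ)  = (s ∸ r) ℕ.+ ascents (s ∷ ρ)

sper : ∀ {n} → Vec ℕ n → ℕ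
sper []              = 0
sper {n} ρ@(r ∷ _)   = n ℕ.+ r ℕ.+ ascents ρ

private
  lookup-∷ʳ-inject₁ : ∀ {n} (ρ : Vec ℕ n) r k → lookup (ρ ∷ʳ r) (inject₁ k) ≡ lookup ρ k
  lookup-∷ʳ-inject₁ (_ ∷ ρ) r zero    = refl
  lookup-∷ʳ-inject₁ (_ ∷ ρ) r (suc k) = lookup-∷ʳ-inject₁ ρ r k

  lookup-∷ʳ-fromℕ : ∀ {n} (ρ : Vec ℕ n) r → lookup (ρ ∷ʳ r) (fromℕ n) ≡ r
  lookup-∷ʳ-fromℕ []      r = refl
  lookup-∷ʳ-fromℕ (_ ∷ ρ) r = lookup-∷ʳ-fromℕ ρ r

  sound : ∀ n {ρ} → ρ ∈ inversionSequences n → IsInversionSequence ρ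
  sound zero    _  ()
  sound (suc n) ρ∈ k
    with ∈-cartesianProductWith⁻ _∷ʳ_ (inversionSequences n) (List.map suc (upTo (suc n))) ρ∈
  ... | σ , r , σ∈ , r∈ , refl with ∈-map⁻ suc r∈
  ...   | m , m∈ , refl with view k
  ...     | ‵fromℕ rewrite lookup-∷ʳ-fromℕ σ (suc m) | toℕ-fromℕ n = s≤s z≤n , ∈-upTo⁻ m∈
  ...     | ‵inject₁ l rewrite lookup-∷ʳ-inject₁ σ (suc m) l | toℕ-inject₁ l = sound n σ∈ l

  complete : ∀ n {ρ} → IsInversionSequence ρ → ρ ∈ inversionSequences n
  complete zero    {[]} _   = here refl
  complete (suc n) {ρ}  inv with initLast ρ
  ... | σ , r , refl = ∈-cartesianProductWith⁺ _∷ʳ_ (complete n σ-inv) (r∈ r (inv (fromℕ n)) (lookup-∷ʳ-fromℕ σ r))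
    where
    σ-inv : IsInversionSequence σ
    σ-inv k with inv (inject₁ k)
    ... | bounds rewrite lookup-∷ʳ-inject₁ σ r k | toℕ-inject₁ k = bounds

    r∈ : ∀ r {s} → 1 ≤ s × s ≤ suc (toℕ (fromℕ n)) → s ≡ r → r ∈ List.map suc (upTo (suc n))
    r∈ (suc m) (_ , m<) refl = ∈-map⁺ suc (∈-upTo⁺ (≡.subst (λ t → m < suc t) (toℕ-fromℕ n) m<))

∈-inversionSequences : ∀ {n} (ρ : Vec ℕ n) → ρ ∈ inversionSequences n ⇔ IsInversionSequence ρ
∈-inversionSequences ρ = mk⇔ (sound _) (complete _)

inversionSequences-unique : ∀ n → Unique (inversionSequences n)
inversionSequences-unique zero    = [] ∷ []
inversionSequences-unique (suc n) =
  Uniqueₚ.cartesianProductWith⁺ _∷ʳ_ (∷ʳ-injective _ _) (inversionSequences-unique n)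
    (Uniqueₚ.map⁺ ℕₚ.suc-injective (Uniqueₚ.upTo⁺ (suc n)))

------------------------------------------------------------------------
-- Formal power series in x over a commutative ring

module PowerSeries {c ℓ} (R : CommutativeRing c ℓ) where

  open CommutativeRing R renaming (refl to ≈-refl) hiding (zero)
  open import Algebra.Properties.Semiring.Exp semiring public using (_^_)
  open import Algebra.Properties.Semiring.Sum semiring
  open import Algebra.Properties.Ring ring using (-‿distribʳ-*)
  open import Algebra.Properties.CommutativeSemigroup *-commutativeSemigroup using (interchange)
  open import Relation.Binary.Reasoning.Setoid setoid

  -- f n is the coefficient of xⁿ.
  Series : Set c
  Series = ℕ → Carrier

  infix  4 _≋_
  infixl 6 _⊕_ _⊖_
  infixl 7 _⊛_

  _≋_ : Series → Series → Set ℓ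
  f ≋ g = ∀ n → f n ≈ g n

  const : Carrier → Series
  const a zero    = a
  const a (suc _) = 0#

  X : Series
  X 1 = 1#
  X _ = 0#

  _⊕_ : Series → Series → Series
  (f ⊕ g) n = f n + g n

  _⊖_ : Series → Series → Series
  (f ⊖ g) n = f n - g n

  _⊛_ : Series → Series → Series
  (f ⊛ g) n = ∑[ k ≤ n ] (f (toℕ k) * g (n ∸ toℕ k))

  rawSemiring-x : RawSemiring c ℓ
  rawSemiring-x = record
    { Carrier = Series
    ; _≈_     = _≋_
    ; _+_     = _⊕_
    ; _*_     = _⊛_
    ; 0#      = const 0#
    ; 1#      = const 1#
    }

  open import Algebra.Definitions.RawSemiring rawSemiring-x public
    using () renaming (_^_ to _^ˣ_; product to productˣ)

  ∏≤ : ℕ → (ℕ → Series) → Series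
  ∏≤ j F = productˣ {suc j} (λ i → F (toℕ i))

  syntax ∏≤ j (λ i → f) = ∏[ i ≤ j ] f

  -- The sum of F j over all j ≥ 0, for families with F j ∈ xʲR[[x]]: the
  -- coefficient of xⁿ then receives contributions from j ≤ n only
  -- (see ∑∞-converges).
  ∑∞ : (ℕ → Series) → Series
  ∑∞ F n = ∑[ j ≤ n ] F (toℕ j) n

  syntax ∑∞ (λ j → f) = ∑∞[ j ] f

  -- The reciprocal of f, where u is an inverse in R of the constant term f 0
  -- (see inverse-correct).  The k-th entry of inverseCoeffs f u n is the
  -- coefficient of xⁿ⁻ᵏ, and f ⊛ g ≋ const 1# forces
  -- g (n + 1) = − u · ∑_{k ≤ n} f (k + 1) · g (n − k).
  inverseCoeffs : Series → Carrier → ∀ n → Vec Carrier (suc n)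
  inverseCoeffs f u zero    = u ∷ []
  inverseCoeffs f u (suc n) =
    - (u * (∑[ k ≤ n ] (f (suc (toℕ k)) * lookup (inverseCoeffs f u n) k))) ∷ inverseCoeffs f u n

  inverse : Series → Carrier → Series
  inverse f u n = Vec.head (inverseCoeffs f u n)

  ∑∞-converges : ∀ F → (∀ j n → n < j → F j n ≈ 0#) →
                 ∀ n N → n ≤ N → ∑[ j ≤ N ] F (toℕ j) n ≈ ∑∞ F n
  ∑∞-converges F small n N n≤N = go (λ j → F j n) (suc n) (suc N) (s≤s n≤N) (λ j → small j n)
    where
    vanish : ∀ (h : ℕ → Carrier) M → (∀ j → h j ≈ 0#) → ∑[ j < M ] h (toℕ j) ≈ 0#
    vanish h zero    h≈0 = ≈-refl
    vanish h (suc M) h≈0 = trans (+-cong (h≈0 0) (vanish (λ j → h (suc j)) M (λ j → h≈0 (suc j)))) (+-identityˡ 0#)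

    go : ∀ (h : ℕ → Carrier) m M → m ≤ M → (∀ j → m ≤ j → h j ≈ 0#) →
         ∑[ j < M ] h (toℕ j) ≈ ∑[ j < m ] h (toℕ j)
    go h zero    M       _         h≈0 = vanish h M (λ j → h≈0 j z≤n)
    go h (suc m) (suc M) (s≤s m≤M) h≈0 =
      +-congˡ (go (λ j → h (suc j)) m M m≤M (λ j m≤j → h≈0 (suc j) (s≤s m≤j)))

  private
    lookup-inverseCoeffs : ∀ f u n (k : Fin (suc n)) →
                           lookup (inverseCoeffs f u n) k ≡ inverse f u (n ∸ toℕ k)
    lookup-inverseCoeffs f u zero    zero    = refl
    lookup-inverseCoeffs f u (suc n) zero    = refl
    lookup-inverseCoeffs f u (suc n) (suc k) = lookup-inverseCoeffs f u n k

  inverse-correct : ∀ f u → f 0 * u ≈ 1# → f ⊛ inverse f u ≋ const 1#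
  inverse-correct f u f₀u≈1 zero    = trans (+-identityʳ _) f₀u≈1
  inverse-correct f u f₀u≈1 (suc n) = begin
    f 0 * - (u * S) + T   ≈⟨ +-cong (-‿distribʳ-* (f 0) (u * S)) (sum-cong-≋ S≈T) ⟨
    - (f 0 * (u * S)) + S ≈⟨ +-congʳ (-‿cong (*-assoc (f 0) u S)) ⟨
    - (f 0 * u * S) + S   ≈⟨ +-congʳ (-‿cong (trans (*-congʳ f₀u≈1) (*-identityˡ S))) ⟩
    - S + S               ≈⟨ -‿inverseˡ S ⟩
    0#                    ∎
    where
    S = ∑[ k ≤ n ] (f (suc (toℕ k)) * lookup (inverseCoeffs f u n) k)
    T = ∑[ k ≤ n ] (f (suc (toℕ k)) * inverse f u (n ∸ toℕ k))

    S≈T : ∀ k → f (suc (toℕ k)) * lookup (inverseCoeffs f u n) k ≈ f (suc (toℕ k)) * inverse f u (n ∸ toℕ k)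
    S≈T k = *-congˡ (reflexive (lookup-inverseCoeffs f u n k))

  ∏-constantTerm : ∀ (F : ℕ → Series) u → (∀ i → F i 0 * u ≈ 1#) →
                   ∀ j → (∏[ i ≤ j ] F i) 0 * u ^ suc j ≈ 1#
  ∏-constantTerm F u F₀u≈1 j = go F F₀u≈1 (suc j)
    where
    go : ∀ (F : ℕ → Series) → (∀ i → F i 0 * u ≈ 1#) →
         ∀ m → productˣ {m} (λ i → F (toℕ i)) 0 * u ^ m ≈ 1#
    go F F₀u≈1 zero    = *-identityˡ 1#
    go F F₀u≈1 (suc m) = begin
      (F 0 0 * P + 0#) * (u * u ^ m)  ≈⟨ *-congʳ (+-identityʳ _) ⟩
      (F 0 0 * P) * (u * u ^ m)       ≈⟨ interchange (F 0 0) P u (u ^ m) ⟩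
      (F 0 0 * u) * (P * u ^ m)       ≈⟨ *-cong (F₀u≈1 0) (go (λ i → F (suc i)) (λ i → F₀u≈1 (suc i)) m) ⟩
      1# * 1#                         ≈⟨ *-identityˡ 1# ⟩
      1#                              ∎
      where P = productˣ {m} (λ i → F (suc (toℕ i))) 0

  ----------------------------------------------------------------------
  -- The generating function of inversion sequences

  ∑∈ : ∀ {a} {B : Set a} → List B → (B → Carrier) → Carrier
  ∑∈ bs h = foldr _+_ 0# (List.map h bs)

  syntax ∑∈ bs (λ b → e) = ∑[ b ∈ bs ] e

  -- The index k is 0-based, so i = suc (toℕ k) runs over 1, …, n.
  a : ℕ → Carrier → Carrier → Carrier → Carrier
  a n y p q = ∑[ k < n ] (y ^ suc (toℕ k) * (∑[ ρ ∈ I n (suc (toℕ k)) ] (p ^ area ρ * q ^ sper ρ)))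

  A : Carrier → Carrier → Carrier → Series
  A y p q zero      = 0#
  A y p q n@(suc _) = a n y p q

{-# OPTIONS --safe #-}
-- For q = 1 the letters of an inversion sequence are independent, so with
-- W n = ∑ p^area over length n one has a (n+1) = W n · ∑_{k ≤ n} (yp)^(k+1) and
-- W (n+1) = W n · p (1 − p^(n+1)) / (1 − p).  The two sums over j are the cases
-- z = 1 and z = yp of
--   F z = ∑_j (−1)^j (zx)^j p^(j + C(j+2,2)) / ∏_{i ≤ j} (1 − p − z x p^(i+1)).
-- Cancelling the factor i = 0 termwise gives the functional equation
-- (1 − p − z x p) · F z = p − z x p³ · F (pz).  On coefficients this is a
-- recurrence in n (uniform in z) whose solution is (1 − p) · [xⁿ] F z = zⁿ W (n+1).
module Submission where

open import Algebra.Bundles using (CommutativeRing; CommutativeSemiring)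
open import Algebra.Structures.Biased using (isCommutativeSemiringˡ)
open import Data.Bool.Base using (true; false; if_then_else_)
open import Data.Fin.Base using (Fin; zero; suc; toℕ)
open import Data.List.Base as List using (List; []; _∷_; _++_; filter; applyUpTo; upTo; cartesianProductWith)
open import Data.Nat.Base as ℕ using (ℕ; zero; suc; _<_; s≤s; _≡ᵇ_)
open import Data.Nat.Combinatorics using (_C_; nC1≡n; nCk+nC[k+1]≡[n+1]C[k+1])
open import Data.Nat.Properties as ℕₚ using (_≟_)
open import Data.Nat.Tactic.RingSolver using (solve-∀)
open import Data.Product.Base using (_,_)
open import Data.Vec.Base as Vec using (Vec; []; _∷_; _∷ʳ_; last)
open import Data.Vec.Properties using (last-∷ʳ)
open import Relation.Binary.Structures using (IsEquivalence)
open import Relation.Binary.PropositionalEquality as ≡ using (_≡_)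
open import Relation.Nullary.Decidable.Core using (does)
open import Relation.Unary using (Pred; Decidable)
open import Defs

-- Areas and the exponents of p

area-∷ʳ : ∀ {n} (ρ : Vec ℕ n) r → area (ρ ∷ʳ r) ≡ area ρ ℕ.+ r
area-∷ʳ []      r = ℕₚ.+-identityʳ r
area-∷ʳ (s ∷ ρ) r = ≡.trans (≡.cong (s ℕ.+_) (area-∷ʳ ρ r)) (≡.sym (ℕₚ.+-assoc s (area ρ) r))

exponent : ℕ → ℕ
exponent j = j ℕ.+ ((j ℕ.+ 2) C 2)

-- Pascal's rule gives C(j+3,2) = (j+2) + C(j+2,2). The increment is written as j + 3 because the
-- two parts go different ways in `numerator-suc`: p^j turns z^j into (pz)^j, and p³ becomes part of
-- `shiftCoeff`.
exponent-suc : ∀ j → exponent (suc j) ≡ exponent j ℕ.+ (j ℕ.+ 3)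
exponent-suc j = begin
  suc j ℕ.+ (suc (j ℕ.+ 2) C 2)                       ≡⟨ ≡.cong (suc j ℕ.+_) (nCk+nC[k+1]≡[n+1]C[k+1] (j ℕ.+ 2) 1) ⟨
  suc j ℕ.+ (((j ℕ.+ 2) C 1) ℕ.+ ((j ℕ.+ 2) C 2))     ≡⟨ ≡.cong (λ t → suc j ℕ.+ (t ℕ.+ ((j ℕ.+ 2) C 2))) (nC1≡n (j ℕ.+ 2)) ⟩
  suc j ℕ.+ ((j ℕ.+ 2) ℕ.+ ((j ℕ.+ 2) C 2))           ≡⟨ rearrange j ((j ℕ.+ 2) C 2) ⟩
  exponent j ℕ.+ (j ℕ.+ 3)                            ∎
  where
  open ≡.≡-Reasoning
  rearrange : ∀ j b → suc j ℕ.+ ((j ℕ.+ 2) ℕ.+ b) ≡ (j ℕ.+ b) ℕ.+ (j ℕ.+ 3)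
  rearrange = solve-∀

module _ {c ℓ} (R : CommutativeRing c ℓ) where

  open CommutativeRing R hiding (zero)
  open PowerSeries R
  open import Algebra.Properties.Ring ring using (-‿distribˡ-*; -1*x≈-x; -0#≈0#)
  open import Algebra.Properties.Semiring.Exp semiring using (^-congʳ; ^-homo-*)
  open import Algebra.Properties.CommutativeSemiring.Exp commutativeSemiring using (^-distrib-*)
  open import Algebra.Properties.Semiring.Sum semiring
  open import Algebra.Solver.Ring.NaturalCoefficients.Default commutativeSemiring
    using (solve; _:+_; _:*_; _:=_; con)
  open import Relation.Binary.Reasoning.Setoid setoid

  -- Cancellation in the coefficient ring

  cancelˡ-unit : ∀ {w u} → w * u ≈ 1# → ∀ {a b} → w * a ≈ w * b → a ≈ b
  cancelˡ-unit {w} {u} wu≈1 {a} {b} wa≈wb = begin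
    a            ≈⟨ reduce a ⟨
    u * (w * a)  ≈⟨ *-congˡ wa≈wb ⟩
    u * (w * b)  ≈⟨ reduce b ⟩
    b            ∎
    where
    reduce : ∀ a → u * (w * a) ≈ a
    reduce a = begin
      u * (w * a)  ≈⟨ *-assoc u w a ⟨
      u * w * a    ≈⟨ *-congʳ (trans (*-comm u w) wu≈1) ⟩
      1# * a       ≈⟨ *-identityˡ a ⟩
      a            ∎

  1^n≈1 : ∀ n → 1# ^ n ≈ 1#
  1^n≈1 zero    = refl
  1^n≈1 (suc n) = trans (*-identityˡ _) (1^n≈1 n)

  -- The solver works over a commutative semiring and treats negated terms as atoms, so each genuine
  -- cancellation has to be made by hand.
  x+-y+y≈x : ∀ x y → x + - y + y ≈ x
  x+-y+y≈x x y = begin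
    x + - y + y    ≈⟨ +-assoc x (- y) y ⟩
    x + (- y + y)  ≈⟨ +-congˡ (-‿inverseˡ y) ⟩
    x + 0#         ≈⟨ +-identityʳ x ⟩
    x              ∎

  -- The ring of formal power series

  -- With this shift, `(f ⊛ g) (suc n)` unfolds by computation to
  -- `f 0 * g (suc n) + (tail f ⊛ g) n`, so laws of the Cauchy product can be proved by induction on
  -- the coefficient index.
  tail : Series → Series
  tail f n = f (suc n)

  ⊛-cong : ∀ {f f′ g g′} → f ≋ f′ → g ≋ g′ → f ⊛ g ≋ f′ ⊛ g′
  ⊛-cong f≋ g≋ n = sum-cong-≋ {suc n} (λ k → *-cong (f≋ (toℕ k)) (g≋ (n ℕ.∸ toℕ k)))

  ⊛-distribʳ-⊕ : ∀ h f g → (f ⊕ g) ⊛ h ≋ f ⊛ h ⊕ g ⊛ h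
  ⊛-distribʳ-⊕ h f g n = trans
    (sum-cong-≋ {suc n} (λ k → distribʳ (h (n ℕ.∸ toℕ k)) (f (toℕ k)) (g (toℕ k))))
    (∑-distrib-+ {suc n} (λ k → f (toℕ k) * h (n ℕ.∸ toℕ k)) (λ k → g (toℕ k) * h (n ℕ.∸ toℕ k)))

  ⊛-scaleˡ : ∀ a f g n → ((λ k → a * f k) ⊛ g) n ≈ a * (f ⊛ g) n
  ⊛-scaleˡ a f g n = trans
    (sum-cong-≋ {suc n} (λ k → *-assoc a (f (toℕ k)) (g (n ℕ.∸ toℕ k))))
    (sym (*-distribˡ-sum {suc n} a (λ k → f (toℕ k) * g (n ℕ.∸ toℕ k))))

  -- By induction on the index, for all series at once: `tail (f ⊛ g)` is `f 0` times `tail g` plus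
  -- `tail f ⊛ g`, and the induction hypothesis is applied to `tail f`.
  ⊛-assoc : ∀ f g h → (f ⊛ g) ⊛ h ≋ f ⊛ (g ⊛ h)
  ⊛-assoc f g h zero =
    solve 3 (λ a b c → (a :* b :+ con 0) :* c :+ con 0 := a :* (b :* c :+ con 0) :+ con 0) refl (f 0) (g 0) (h 0)
  ⊛-assoc f g h (suc n) = begin
    (f 0 * g 0 + 0#) * h (suc n) + (tail (f ⊛ g) ⊛ h) n
      ≈⟨ +-congˡ (⊛-distribʳ-⊕ h (λ k → f 0 * tail g k) (tail f ⊛ g) n) ⟩
    (f 0 * g 0 + 0#) * h (suc n) + (((λ k → f 0 * tail g k) ⊛ h) n + ((tail f ⊛ g) ⊛ h) n)
      ≈⟨ +-congˡ (+-cong (⊛-scaleˡ (f 0) (tail g) h n) (⊛-assoc (tail f) g h n)) ⟩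
    (f 0 * g 0 + 0#) * h (suc n) + (f 0 * (tail g ⊛ h) n + (tail f ⊛ (g ⊛ h)) n)
      ≈⟨ solve 5 (λ a b c d e → (a :* b :+ con 0) :* c :+ (a :* d :+ e) := a :* (b :* c :+ d) :+ e) refl
           (f 0) (g 0) (h (suc n)) ((tail g ⊛ h) n) ((tail f ⊛ (g ⊛ h)) n) ⟩
    f 0 * (g 0 * h (suc n) + (tail g ⊛ h) n) + (tail f ⊛ (g ⊛ h)) n ∎

  -- The mirror image of the computational unfolding: the last summand of the Cauchy product is
  -- split off instead of the first. Comparing the two splittings gives commutativity.
  ⊛-sucʳ : ∀ f g n → (f ⊛ g) (suc n) ≈ g 0 * f (suc n) + (f ⊛ tail g) n
  ⊛-sucʳ f g zero =
    solve 4 (λ a b c d → a :* b :+ (c :* d :+ con 0) := d :* c :+ (a :* b :+ con 0)) refl (f 0) (g 1) (f 1) (g 0)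
  ⊛-sucʳ f g (suc n) = begin
    f 0 * g (suc (suc n)) + (tail f ⊛ g) (suc n)
      ≈⟨ +-congˡ (⊛-sucʳ (tail f) g n) ⟩
    f 0 * g (suc (suc n)) + (g 0 * f (suc (suc n)) + (tail f ⊛ tail g) n)
      ≈⟨ solve 3 (λ a b c → a :+ (b :+ c) := b :+ (a :+ c)) refl _ _ _ ⟩
    g 0 * f (suc (suc n)) + (f 0 * g (suc (suc n)) + (tail f ⊛ tail g) n) ∎

  ⊛-comm : ∀ f g → f ⊛ g ≋ g ⊛ f
  ⊛-comm f g zero    = +-congʳ (*-comm (f 0) (g 0))
  ⊛-comm f g (suc n) = trans (+-congˡ (⊛-comm (tail f) g n)) (sym (⊛-sucʳ g f n))

  0⊛ : ∀ f n → ((λ _ → 0#) ⊛ f) n ≈ 0#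
  0⊛ f n = trans (sum-cong-≋ {suc n} (λ k → zeroˡ (f (n ℕ.∸ toℕ k)))) (sum-replicate-zero (suc n))

  const-⊛ : ∀ a f n → (const a ⊛ f) n ≈ a * f n
  const-⊛ a f zero    = +-identityʳ (a * f 0)
  const-⊛ a f (suc n) = trans (+-congˡ (0⊛ f n)) (+-identityʳ (a * f (suc n)))

  const-0 : ∀ n → const 0# n ≈ 0#
  const-0 zero    = refl
  const-0 (suc n) = refl

  -- Packaged so that the solver and setoid reasoning apply to series as they do to coefficients.
  series-commutativeSemiring : CommutativeSemiring c ℓ
  series-commutativeSemiring = record
    { Carrier = Series
    ; _≈_ = _≋_
    ; _+_ = _⊕_
    ; _*_ = _⊛_
    ; 0# = const 0#
    ; 1# = const 1#
    ; isCommutativeSemiring = isCommutativeSemiringˡ record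
      { +-isCommutativeMonoid = record
        { isMonoid = record
          { isSemigroup = record
            { isMagma = record
              { isEquivalence = ≋-isEquivalence
              ; ∙-cong = λ f≋ g≋ n → +-cong (f≋ n) (g≋ n)
              }
            ; assoc = λ f g h n → +-assoc (f n) (g n) (h n)
            }
          ; identity = (λ f n → trans (+-congʳ (const-0 n)) (+-identityˡ (f n)))
                     , (λ f n → trans (+-congˡ (const-0 n)) (+-identityʳ (f n)))
          }
        ; comm = λ f g n → +-comm (f n) (g n)
        }
      ; *-isCommutativeMonoid = record
        { isMonoid = record
          { isSemigroup = record
            { isMagma = record
              { isEquivalence = ≋-isEquivalence
              ; ∙-cong = ⊛-cong
              }
            ; assoc = ⊛-assoc
            }
          ; identity = 1⊛ , (λ f n → trans (⊛-comm f (const 1#) n) (1⊛ f n))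
          }
        ; comm = ⊛-comm
        }
      ; distribʳ = ⊛-distribʳ-⊕
      ; zeroˡ = λ f n → trans (const-⊛ 0# f n) (trans (zeroˡ (f n)) (sym (const-0 n)))
      }
    }
    where
    ≋-isEquivalence : IsEquivalence _≋_
    ≋-isEquivalence = record
      { refl  = λ n → refl
      ; sym   = λ f≋g n → sym (f≋g n)
      ; trans = λ f≋g g≋h n → trans (f≋g n) (g≋h n)
      }

    1⊛ : ∀ f → const 1# ⊛ f ≋ f
    1⊛ f n = trans (const-⊛ 1# f n) (*-identityˡ (f n))

  module S where
    open CommutativeSemiring series-commutativeSemiring public
    open import Algebra.Solver.Ring.NaturalCoefficients.Default series-commutativeSemiring public
      using (solve; _:*_; _:=_)
    open import Relation.Binary.Reasoning.Setoid (CommutativeSemiring.setoid series-commutativeSemiring) public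

  const-cong : ∀ {a b} → a ≈ b → const a ≋ const b
  const-cong a≈b zero    = a≈b
  const-cong a≈b (suc n) = refl

  const-* : ∀ a b → const (a * b) ≋ const a ⊛ const b
  const-* a b zero    = sym (const-⊛ a (const b) 0)
  const-* a b (suc n) = sym (trans (const-⊛ a (const b) (suc n)) (zeroʳ a))

  X⊛-zero : ∀ f → (X ⊛ f) 0 ≈ 0#
  X⊛-zero f = trans (+-identityʳ (0# * f 0)) (zeroˡ (f 0))

  X⊛-suc : ∀ f n → (X ⊛ f) (suc n) ≈ f n
  X⊛-suc f n = begin
    0# * f (suc n) + (tail X ⊛ f) n  ≈⟨ +-cong (zeroˡ (f (suc n))) (⊛-cong {g = f} tail-X (λ _ → refl) n) ⟩
    0# + (const 1# ⊛ f) n            ≈⟨ +-identityˡ _ ⟩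
    (const 1# ⊛ f) n                 ≈⟨ S.*-identityˡ f n ⟩
    f n                              ∎
    where
    tail-X : tail X ≋ const 1#
    tail-X zero    = refl
    tail-X (suc n) = refl

  X^⊛-small : ∀ f j n → n < j → (X ^ˣ j ⊛ f) n ≈ 0#
  X^⊛-small f (suc j) zero    _         = trans (⊛-assoc X (X ^ˣ j) f 0) (X⊛-zero (X ^ˣ j ⊛ f))
  X^⊛-small f (suc j) (suc n) (s≤s n<j) = begin
    (X ⊛ X ^ˣ j ⊛ f) (suc n)    ≈⟨ ⊛-assoc X (X ^ˣ j) f (suc n) ⟩
    (X ⊛ (X ^ˣ j ⊛ f)) (suc n)  ≈⟨ X⊛-suc (X ^ˣ j ⊛ f) n ⟩
    (X ^ˣ j ⊛ f) n              ≈⟨ X^⊛-small f j n n<j ⟩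
    0#                          ∎

  -- Allows reciprocals to be compared through their defining equations, without unfolding the
  -- recursion behind `inverse`.
  inverse-unique : ∀ {f g h} → f ⊛ g ≋ const 1# → f ⊛ h ≋ const 1# → g ≋ h
  inverse-unique {f} {g} {h} fg≋1 fh≋1 = S.begin
    g                 S.≈⟨ S.*-identityʳ g ⟨
    g ⊛ const 1#      S.≈⟨ S.*-congˡ {g} fh≋1 ⟨
    g ⊛ (f ⊛ h)       S.≈⟨ S.solve 3 (λ g f h → g S.:* (f S.:* h) S.:= (f S.:* g) S.:* h) S.refl g f h ⟩
    f ⊛ g ⊛ h         S.≈⟨ S.*-congʳ {h} fg≋1 ⟩
    const 1# ⊛ h      S.≈⟨ S.*-identityˡ h ⟩
    h                 S.∎

  -- The linear factors w - cx of the denominators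

  linear : Carrier → Carrier → Series
  linear w c = const w ⊖ X ⊛ const c

  linear-cong : ∀ w {c d} → c ≈ d → linear w c ≋ linear w d
  linear-cong w c≈d n = +-congˡ (-‿cong (S.*-congˡ {X} (const-cong c≈d) n))

  linear-constantTerm : ∀ w c → linear w c 0 ≈ w
  linear-constantTerm w c = begin
    w - (X ⊛ const c) 0  ≈⟨ +-congˡ (-‿cong (X⊛-zero (const c))) ⟩
    w - 0#               ≈⟨ +-congˡ -0#≈0# ⟩
    w + 0#               ≈⟨ +-identityʳ w ⟩
    w                    ∎

  linear-⊛-zero : ∀ w c f → (linear w c ⊛ f) 0 ≈ w * f 0
  linear-⊛-zero w c f = trans (+-identityʳ _) (*-congʳ (linear-constantTerm w c))

  -- The coefficient of x^(n+1) in (w - cx)f, with the subtracted term moved to the other side. In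
  -- this form it turns an equation for (w - cx)f into a recurrence for the coefficients of f.
  linear-⊛-suc : ∀ w c f n → w * f (suc n) ≈ (linear w c ⊛ f) (suc n) + c * f n
  linear-⊛-suc w c f n = sym (begin
    linear w c 0 * f (suc n) + (tail (linear w c) ⊛ f) n + c * f n
      ≈⟨ +-congʳ (+-cong (*-congʳ (linear-constantTerm w c)) (⊛-cong {g = f} tail-linear (λ _ → refl) n)) ⟩
    w * f (suc n) + (const (- c) ⊛ f) n + c * f n
      ≈⟨ +-congʳ (+-congˡ (trans (const-⊛ (- c) f n) (sym (-‿distribˡ-* c (f n))))) ⟩
    w * f (suc n) + - (c * f n) + c * f n
      ≈⟨ x+-y+y≈x (w * f (suc n)) (c * f n) ⟩
    w * f (suc n) ∎)
    where
    tail-linear : tail (linear w c) ≋ const (- c)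
    tail-linear zero    = trans (+-identityˡ _) (-‿cong (X⊛-suc (const c) 0))
    tail-linear (suc n) = trans (+-identityˡ _) (trans (-‿cong (X⊛-suc (const c) (suc n))) -0#≈0#)

  ∏-cong : ∀ {F G : ℕ → Series} → (∀ i → F i ≋ G i) → ∀ j → ∏≤ j F ≋ ∏≤ j G
  ∏-cong F≋G j = go (suc j) F≋G
    where
    go : ∀ m {F G : ℕ → Series} → (∀ i → F i ≋ G i) → productˣ {m} (λ i → F (toℕ i)) ≋ productˣ {m} (λ i → G (toℕ i))
    go zero    F≋G = S.refl
    go (suc m) F≋G = S.*-cong (F≋G 0) (go m (λ i → F≋G (suc i)))

  ∑∞-cong : ∀ {F G : ℕ → Series} → (∀ j → F j ≋ G j) → ∑∞ F ≋ ∑∞ G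
  ∑∞-cong F≋G n = sum-cong-≋ {suc n} (λ j → F≋G (toℕ j) n)

  -- Sums over inversion sequences

  ∑∈-cong : ∀ {b} {B : Set b} (xs : List B) {g h : B → Carrier} → (∀ x → g x ≈ h x) → ∑∈ xs g ≈ ∑∈ xs h
  ∑∈-cong []       g≈h = refl
  ∑∈-cong (x ∷ xs) g≈h = +-cong (g≈h x) (∑∈-cong xs g≈h)

  ∑∈-*ʳ : ∀ {b} {B : Set b} (xs : List B) (h : B → Carrier) a → ∑∈ xs (λ x → h x * a) ≈ ∑∈ xs h * a
  ∑∈-*ʳ []       h a = sym (zeroˡ a)
  ∑∈-*ʳ (x ∷ xs) h a = trans (+-congˡ (∑∈-*ʳ xs h a)) (sym (distribʳ a (h x) (∑∈ xs h)))

  ∑∈-++ : ∀ {b} {B : Set b} (xs ys : List B) (h : B → Carrier) → ∑∈ (xs ++ ys) h ≈ ∑∈ xs h + ∑∈ ys h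
  ∑∈-++ []       ys h = sym (+-identityˡ (∑∈ ys h))
  ∑∈-++ (x ∷ xs) ys h = trans (+-congˡ (∑∈-++ xs ys h)) (sym (+-assoc (h x) (∑∈ xs h) (∑∈ ys h)))

  ∑∈-map : ∀ {b d} {B : Set b} {D : Set d} (f : B → D) xs (h : D → Carrier) → ∑∈ (List.map f xs) h ≈ ∑∈ xs (λ x → h (f x))
  ∑∈-map f []       h = refl
  ∑∈-map f (x ∷ xs) h = +-congˡ (∑∈-map f xs h)

  ∑∈-cartesianProductWith : ∀ {b d e} {B : Set b} {D : Set d} {E : Set e} (f : B → D → E) xs ys (h : E → Carrier) →
    ∑∈ (cartesianProductWith f xs ys) h ≈ ∑[ x ∈ xs ] (∑[ y ∈ ys ] h (f x y))
  ∑∈-cartesianProductWith f []       ys h = refl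
  ∑∈-cartesianProductWith f (x ∷ xs) ys h = trans
    (∑∈-++ (List.map (f x) ys) (cartesianProductWith f xs ys) h)
    (+-cong (∑∈-map (f x) ys h) (∑∈-cartesianProductWith f xs ys h))

  ∑∈-filter : ∀ {b q} {B : Set b} {Q : Pred B q} (Q? : Decidable Q) xs (h : B → Carrier) →
    ∑∈ (filter Q? xs) h ≈ ∑[ x ∈ xs ] (if does (Q? x) then h x else 0#)
  ∑∈-filter Q? []       h = refl
  ∑∈-filter Q? (x ∷ xs) h with does (Q? x)
  ... | true  = +-congˡ (∑∈-filter Q? xs h)
  ... | false = trans (∑∈-filter Q? xs h) (sym (+-identityˡ _))

  ∑∈-applyUpTo : ∀ {b} {B : Set b} (f : ℕ → B) n (h : B → Carrier) → ∑∈ (applyUpTo f n) h ≈ ∑[ k < n ] h (f (toℕ k))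
  ∑∈-applyUpTo f zero    h = refl
  ∑∈-applyUpTo f (suc n) h = +-congˡ (∑∈-applyUpTo (λ k → f (suc k)) n h)

  -- The test is `≡ᵇ` because `does (suc r ≟ suc m)` computes to `r ≡ᵇ m`.
  ∑-indicator : ∀ {n} (k : Fin n) (h : ℕ → Carrier) →
    ∑[ r < n ] (if toℕ r ≡ᵇ toℕ k then h (toℕ r) else 0#) ≈ h (toℕ k)
  ∑-indicator {suc n} zero    h = trans (+-congˡ (sum-replicate-zero n)) (+-identityʳ (h 0))
  ∑-indicator {suc n} (suc k) h = trans (+-identityˡ _) (∑-indicator k (λ r → h (suc r)))

  -- The range of the last letter does not depend on the prefix, so the sum over length n+1 is an
  -- iterated sum.
  ∑-inversionSequences-suc : ∀ n (h : Vec ℕ (suc n) → Carrier) →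
    ∑∈ (inversionSequences (suc n)) h ≈ ∑[ ρ ∈ inversionSequences n ] (∑[ r ≤ n ] h (ρ ∷ʳ suc (toℕ r)))
  ∑-inversionSequences-suc n h = trans
    (∑∈-cartesianProductWith _∷ʳ_ (inversionSequences n) (List.map suc (upTo (suc n))) h)
    (∑∈-cong (inversionSequences n) (λ ρ → trans
      (∑∈-map suc (upTo (suc n)) (λ r → h (ρ ∷ʳ r)))
      (∑∈-applyUpTo (λ r → r) (suc n) (λ r → h (ρ ∷ʳ suc r)))))

  -- Finite geometric sums

  geometric : Carrier → ℕ → Carrier
  geometric t n = ∑[ k < n ] (t ^ suc (toℕ k))

  geometric-suc : ∀ t n → geometric t (suc n) ≈ t * (1# + geometric t n)
  geometric-suc t n = begin
    t * 1# + ∑[ k < n ] (t * t ^ suc (toℕ k))  ≈⟨ +-congˡ (*-distribˡ-sum {n} t (λ k → t ^ suc (toℕ k))) ⟨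
    t * 1# + t * geometric t n                 ≈⟨ distribˡ t 1# (geometric t n) ⟨
    t * (1# + geometric t n)                   ∎

  -- `telescope` is the subtraction-free form G + t^(n+1) = t + tG; adding and removing t^(n+1)
  -- reduces the claim to it. The right side has `- 1#` as a factor, which the semiring solver can
  -- carry as an atom in later products.
  geometric-closed : ∀ t n → (1# - t) * geometric t n ≈ t + - 1# * t ^ suc n
  geometric-closed t n = begin
    (1# - t) * G                    ≈⟨ distribʳ G 1# (- t) ⟩
    1# * G + - t * G                ≈⟨ +-cong (*-identityˡ G) (sym (-‿distribˡ-* t G)) ⟩
    G - t * G                       ≈⟨ +-congʳ (x+-y+y≈x G b) ⟨
    G + - b + b - t * G             ≈⟨ solve 4 (λ g nb b ntg → g :+ nb :+ b :+ ntg := g :+ b :+ ntg :+ nb) refl G (- b) b (- (t * G)) ⟩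
    G + b - t * G - b               ≈⟨ +-congʳ (+-congʳ (telescope n)) ⟩
    t + t * G - t * G - b           ≈⟨ +-congʳ (+-assoc t (t * G) (- (t * G))) ⟩
    t + (t * G - t * G) - b         ≈⟨ +-cong (trans (+-congˡ (-‿inverseʳ (t * G))) (+-identityʳ t)) (sym (-1*x≈-x b)) ⟩
    t + - 1# * b                    ∎
    where
    G = geometric t n
    b = t ^ suc n

    telescope : ∀ n → geometric t n + t ^ suc n ≈ t + t * geometric t n
    telescope zero    = solve 1 (λ t → con 0 :+ t :* con 1 := t :+ t :* con 0) refl t
    telescope (suc n) = begin
      geometric t (suc n) + t * t ^ suc n          ≈⟨ +-congʳ (geometric-suc t n) ⟩
      t * (1# + geometric t n) + t * t ^ suc n     ≈⟨ solve 3 (λ t g b → t :* (con 1 :+ g) :+ t :* b := t :+ t :* (g :+ b)) refl t (geometric t n) (t ^ suc n) ⟩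
      t + t * (geometric t n + t ^ suc n)          ≈⟨ +-congˡ (*-congˡ (telescope n)) ⟩
      t + t * (t + t * geometric t n)              ≈⟨ solve 2 (λ t g → t :+ t :* (t :+ t :* g) := t :+ t :* (t :* (con 1 :+ g))) refl t (geometric t n) ⟩
      t + t * (t * (1# + geometric t n))           ≈⟨ +-congˡ (*-congˡ (geometric-suc t n)) ⟨
      t + t * geometric t (suc n)                  ∎

  -- The area generating function of inversion sequences

  module _ (p : Carrier) where

    areaSum : ℕ → Carrier
    areaSum n = ∑[ ρ ∈ inversionSequences n ] (p ^ area ρ)

    p^area-∷ʳ : ∀ {n} (ρ : Vec ℕ n) r → p ^ area (ρ ∷ʳ r) ≈ p ^ area ρ * p ^ r
    p^area-∷ʳ ρ r = trans (^-congʳ p (area-∷ʳ ρ r)) (^-homo-* p (area ρ) r)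

    areaSum-suc : ∀ n → areaSum (suc n) ≈ areaSum n * geometric p (suc n)
    areaSum-suc n = begin
      areaSum (suc n)
        ≈⟨ ∑-inversionSequences-suc n (λ ρ → p ^ area ρ) ⟩
      ∑[ ρ ∈ inversionSequences n ] (∑[ r ≤ n ] (p ^ area (ρ ∷ʳ suc (toℕ r))))
        ≈⟨ ∑∈-cong (inversionSequences n) (λ ρ → trans
             (sum-cong-≋ {suc n} (λ r → p^area-∷ʳ ρ (suc (toℕ r))))
             (sym (*-distribˡ-sum {suc n} (p ^ area ρ) (λ r → p ^ suc (toℕ r))))) ⟩
      ∑[ ρ ∈ inversionSequences n ] (p ^ area ρ * geometric p (suc n))
        ≈⟨ ∑∈-*ʳ (inversionSequences n) (λ ρ → p ^ area ρ) (geometric p (suc n)) ⟩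
      areaSum n * geometric p (suc n) ∎

    ∑-I : ∀ n (k : Fin (suc n)) → ∑[ ρ ∈ I (suc n) (suc (toℕ k)) ] (p ^ area ρ) ≈ areaSum n * p ^ suc (toℕ k)
    ∑-I n k = begin
      ∑[ ρ ∈ I (suc n) (suc (toℕ k)) ] (p ^ area ρ)
        ≈⟨ ∑∈-filter (λ ρ → last ρ ≟ suc (toℕ k)) (inversionSequences (suc n)) (λ ρ → p ^ area ρ) ⟩
      ∑[ ρ ∈ inversionSequences (suc n) ] weight ρ
        ≈⟨ ∑-inversionSequences-suc n weight ⟩
      ∑[ ρ ∈ inversionSequences n ] (∑[ r ≤ n ] weight (ρ ∷ʳ suc (toℕ r)))
        ≈⟨ ∑∈-cong (inversionSequences n) (λ ρ → trans
             (sum-cong-≋ {suc n} (λ r → weight-∷ʳ ρ (toℕ r)))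
             (∑-indicator k (λ r → p ^ area (ρ ∷ʳ suc r)))) ⟩
      ∑[ ρ ∈ inversionSequences n ] (p ^ area (ρ ∷ʳ suc (toℕ k)))
        ≈⟨ ∑∈-cong (inversionSequences n) (λ ρ → p^area-∷ʳ ρ (suc (toℕ k))) ⟩
      ∑[ ρ ∈ inversionSequences n ] (p ^ area ρ * p ^ suc (toℕ k))
        ≈⟨ ∑∈-*ʳ (inversionSequences n) (λ ρ → p ^ area ρ) (p ^ suc (toℕ k)) ⟩
      areaSum n * p ^ suc (toℕ k) ∎
      where
      weight : Vec ℕ (suc n) → Carrier
      weight ρ = if does (last ρ ≟ suc (toℕ k)) then p ^ area ρ else 0#

      weight-∷ʳ : ∀ (ρ : Vec ℕ n) r → weight (ρ ∷ʳ suc r) ≈ (if r ≡ᵇ toℕ k then p ^ area (ρ ∷ʳ suc r) else 0#)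
      -- Once the last letter is known to be `suc r`, the decision computes to the Boolean test of
      -- `∑-indicator`.
      weight-∷ʳ ρ r = reflexive (≡.cong (λ l → if does (l ≟ suc (toℕ k)) then p ^ area (ρ ∷ʳ suc r) else 0#) (last-∷ʳ (suc r) ρ))

    -- At q = 1 the semi-perimeter weight is 1. Fixing the last letter i leaves a free prefix and
    -- contributes y^i p^i, so the sum over i is a geometric sum in yp.
    a-closed : ∀ y n → a (suc n) y p 1# ≈ areaSum n * geometric (y * p) (suc n)
    a-closed y n = trans
      (sum-cong-≋ {suc n} coefficient)
      (sym (*-distribˡ-sum {suc n} (areaSum n) (λ k → (y * p) ^ suc (toℕ k))))
      where
      coefficient : ∀ (k : Fin (suc n)) →
        y ^ suc (toℕ k) * (∑[ ρ ∈ I (suc n) (suc (toℕ k)) ] (p ^ area ρ * 1# ^ sper ρ)) ≈ areaSum n * (y * p) ^ suc (toℕ k)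
      coefficient k = begin
        y ^ i * (∑[ ρ ∈ I (suc n) i ] (p ^ area ρ * 1# ^ sper ρ))
          ≈⟨ *-congˡ (∑∈-cong (I (suc n) i) (λ ρ → trans (*-congˡ (1^n≈1 (sper ρ))) (*-identityʳ _))) ⟩
        y ^ i * (∑[ ρ ∈ I (suc n) i ] (p ^ area ρ))
          ≈⟨ *-congˡ (∑-I n k) ⟩
        y ^ i * (areaSum n * p ^ i)
          ≈⟨ solve 3 (λ a b c → a :* (b :* c) := b :* (a :* c)) refl (y ^ i) (areaSum n) (p ^ i) ⟩
        areaSum n * (y ^ i * p ^ i)
          ≈⟨ *-congˡ (^-distrib-* y p i) ⟨
        areaSum n * (y * p) ^ i ∎
        where i = suc (toℕ k)

    -- The q-series F z

    numerator : Carrier → ℕ → Carrier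
    numerator z j = z ^ j * p ^ exponent j

    -- The coefficient for which `linear (1# - p) (root z i)` is the denominator factor 1 - p - z x
    -- p^(i+1).
    root : Carrier → ℕ → Carrier
    root z i = z * p ^ (i ℕ.+ 1)

    shiftCoeff : Carrier → Carrier
    shiftCoeff z = - 1# * z * p ^ 3

    -- Raising j by one amounts to replacing z by pz, at the cost of the factor -zp³. This and
    -- `root-suc` are the source of F(pz) in the functional equation.
    numerator-suc : ∀ z j → (- 1#) ^ suc j * numerator z (suc j) ≈ shiftCoeff z * ((- 1#) ^ j * numerator (p * z) j)
    numerator-suc z j = begin
      - 1# * (- 1#) ^ j * (z * z ^ j * p ^ exponent (suc j))
        ≈⟨ *-congˡ (*-congˡ (trans (^-congʳ p (exponent-suc j)) (trans (^-homo-* p (exponent j) (j ℕ.+ 3)) (*-congˡ (^-homo-* p j 3))))) ⟩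
      - 1# * (- 1#) ^ j * (z * z ^ j * (p ^ exponent j * (p ^ j * p ^ 3)))
        ≈⟨ solve 7 (λ m mj z zj pe pj p³ → m :* mj :* (z :* zj :* (pe :* (pj :* p³))) := m :* z :* p³ :* (mj :* (pj :* zj :* pe))) refl
             (- 1#) ((- 1#) ^ j) z (z ^ j) (p ^ exponent j) (p ^ j) (p ^ 3) ⟩
      shiftCoeff z * ((- 1#) ^ j * (p ^ j * z ^ j * p ^ exponent j))
        ≈⟨ *-congˡ (*-congˡ (*-congʳ (^-distrib-* p z j))) ⟨
      shiftCoeff z * ((- 1#) ^ j * numerator (p * z) j) ∎

    root-suc : ∀ z i → root z (suc i) ≈ root (p * z) i
    root-suc z i = solve 3 (λ z p q → z :* (p :* q) := p :* z :* q) refl z p (p ^ (i ℕ.+ 1))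

    numerator-one : ∀ j → numerator 1# j ≈ p ^ exponent j
    numerator-one j = trans (*-congʳ (1^n≈1 j)) (*-identityˡ _)

    -- The p^j contained in (yp)^j is what raises the exponent j + C(j+2,2) of the first sum to the
    -- 2j + C(j+2,2) of the second.
    numerator-yp : ∀ y j → numerator (y * p) j ≈ y ^ j * p ^ (2 ℕ.* j ℕ.+ ((j ℕ.+ 2) C 2))
    numerator-yp y j = begin
      (y * p) ^ j * p ^ exponent j         ≈⟨ *-congʳ (^-distrib-* y p j) ⟩
      y ^ j * p ^ j * p ^ exponent j       ≈⟨ *-assoc (y ^ j) (p ^ j) (p ^ exponent j) ⟩
      y ^ j * (p ^ j * p ^ exponent j)     ≈⟨ *-congˡ (^-homo-* p j (exponent j)) ⟨
      y ^ j * p ^ (j ℕ.+ exponent j)       ≈⟨ *-congˡ (^-congʳ p (rearrange j ((j ℕ.+ 2) C 2))) ⟩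
      y ^ j * p ^ (2 ℕ.* j ℕ.+ ((j ℕ.+ 2) C 2)) ∎
      where
      rearrange : ∀ j b → j ℕ.+ (j ℕ.+ b) ≡ 2 ℕ.* j ℕ.+ b
      rearrange = solve-∀

    root-yp : ∀ y i → root (y * p) i ≈ y * p ^ (i ℕ.+ 2)
    root-yp y i = begin
      y * p * p ^ (i ℕ.+ 1)      ≈⟨ *-assoc y p (p ^ (i ℕ.+ 1)) ⟩
      y * p ^ suc (i ℕ.+ 1)      ≈⟨ *-congˡ (^-congʳ p (ℕₚ.+-suc i 1)) ⟨
      y * p ^ (i ℕ.+ 2)          ∎

    -- Reciprocals of the denominators

    module _ (u : Carrier) (wu≈1 : (1# - p) * u ≈ 1#) where

      w : Carrier
      w = 1# - p

      denominator : (ℕ → Carrier) → ℕ → Series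
      denominator d j = ∏[ i ≤ j ] linear w (d i)

      recip : (ℕ → Carrier) → ℕ → Series
      recip d j = inverse (denominator d j) (u ^ suc j)

      denominator⊛recip : ∀ d j → denominator d j ⊛ recip d j ≋ const 1#
      denominator⊛recip d j = inverse-correct (denominator d j) (u ^ suc j)
        (∏-constantTerm (λ i → linear w (d i)) u (λ i → trans (*-congʳ (linear-constantTerm w (d i))) wu≈1) j)

      recip-cong : ∀ {d e} → (∀ i → d i ≈ e i) → ∀ j → recip d j ≋ recip e j
      recip-cong {d} {e} d≈e j = inverse-unique {denominator d j} (denominator⊛recip d j)
        (S.trans (S.*-congʳ {recip e j} (∏-cong (λ i → linear-cong w (d≈e i)) j)) (denominator⊛recip e j))

      -- Multiplication by the factor i = 0 cancels it from the reciprocal. Both sides are inverse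
      -- to the product of the remaining factors, hence equal by uniqueness.
      recip-suc : ∀ d j → linear w (d 0) ⊛ recip d (suc j) ≋ recip (λ i → d (suc i)) j
      recip-suc d j = inverse-unique {denominator d′ j}
        (S.trans
          (S.solve 3 (λ a b c → a S.:* (b S.:* c) S.:= (b S.:* a) S.:* c) S.refl
            (denominator d′ j) (linear w (d 0)) (recip d (suc j)))
          (denominator⊛recip d (suc j)))
        (denominator⊛recip d′ j)
        where
        d′ : ℕ → Carrier
        d′ i = d (suc i)

      -- Numerators and denominator coefficients are left arbitrary, so that the summands of the
      -- theorem and those of F z are instances of one expression, related by `generalTerm-cong`.
      generalTerm : (ℕ → Carrier) → (ℕ → Carrier) → ℕ → Series
      generalTerm e d j = const ((- 1#) ^ j) ⊛ X ^ˣ j ⊛ const (e j) ⊛ recip d j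

      generalTerm-cong : ∀ {e e′ d d′} → (∀ j → e j ≈ e′ j) → (∀ i → d i ≈ d′ i) →
                         ∀ j → generalTerm e d j ≋ generalTerm e′ d′ j
      generalTerm-cong e≈e′ d≈d′ j = S.*-cong (S.*-congˡ {const ((- 1#) ^ j) ⊛ X ^ˣ j} (const-cong (e≈e′ j))) (recip-cong d≈d′ j)

      -- The factor `X ^ˣ j` is brought to the front. This is the hypothesis of `∑∞-converges`.
      generalTerm-small : ∀ e d j n → n < j → generalTerm e d j n ≈ 0#
      generalTerm-small e d j n n<j = trans
        (S.solve 4 (λ a x b q → a S.:* x S.:* b S.:* q S.:= x S.:* (a S.:* b S.:* q)) S.refl
          (const ((- 1#) ^ j)) (X ^ˣ j) (const (e j)) (recip d j) n)
        (X^⊛-small (const ((- 1#) ^ j) ⊛ const (e j) ⊛ recip d j) j n n<j)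

      -- The functional equation of F and its solution

      term : Carrier → ℕ → Series
      term z = generalTerm (numerator z) (root z)

      F : Carrier → Series
      F z = ∑∞ (term z)

      term-zero : ∀ z → linear w (root z 0) ⊛ term z 0 ≋ const p
      term-zero z = S.begin
        D ⊛ (const 1# ⊛ const 1# ⊛ const (numerator z 0) ⊛ Q)
          S.≈⟨ S.*-congˡ {D} (S.*-congʳ {Q} (S.trans (S.*-congʳ {const (numerator z 0)} (S.*-identityˡ (const 1#))) (S.*-identityˡ (const (numerator z 0))))) ⟩
        D ⊛ (const (numerator z 0) ⊛ Q)
          S.≈⟨ S.solve 3 (λ d a q → d S.:* (a S.:* q) S.:= a S.:* (d S.:* q)) S.refl D (const (numerator z 0)) Q ⟩
        const (numerator z 0) ⊛ (D ⊛ Q)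
          -- `exponent 0` computes to 1, since C(2,2) = 1, and the one-factor product
          -- `denominator (root z) 0` is `D ⊛ const 1#`.
          S.≈⟨ S.*-cong (const-cong (trans (*-identityˡ (p * 1#)) (*-identityʳ p))) (S.trans (S.*-congʳ {Q} (S.sym (S.*-identityʳ D))) (denominator⊛recip (root z) 0)) ⟩
        const p ⊛ const 1#
          S.≈⟨ S.*-identityʳ (const p) ⟩
        const p S.∎
        where
        D = linear w (root z 0)
        Q = recip (root z) 0

      term-suc : ∀ z j → linear w (root z 0) ⊛ term z (suc j) ≋ X ⊛ (const (shiftCoeff z) ⊛ term (p * z) j)
      term-suc z j = S.begin
        D ⊛ (const m ⊛ (X ⊛ X ^ˣ j) ⊛ const e ⊛ recip (root z) (suc j))
          S.≈⟨ S.solve 6 (λ d m x xj e q → d S.:* (m S.:* (x S.:* xj) S.:* e S.:* q) S.:= x S.:* ((m S.:* e) S.:* xj S.:* (d S.:* q))) S.refl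
                 D (const m) X (X ^ˣ j) (const e) (recip (root z) (suc j)) ⟩
        X ⊛ (const m ⊛ const e ⊛ X ^ˣ j ⊛ (D ⊛ recip (root z) (suc j)))
          S.≈⟨ S.*-congˡ {X} (S.*-cong (S.*-congʳ {X ^ˣ j} coefficients) (S.trans (recip-suc (root z) j) (recip-cong (root-suc z) j))) ⟩
        X ⊛ (const (shiftCoeff z) ⊛ (const m′ ⊛ const e′) ⊛ X ^ˣ j ⊛ recip (root (p * z)) j)
          S.≈⟨ S.*-congˡ {X} (S.solve 5 (λ s m e xj q → s S.:* (m S.:* e) S.:* xj S.:* q S.:= s S.:* (m S.:* xj S.:* e S.:* q)) S.refl
                 (const (shiftCoeff z)) (const m′) (const e′) (X ^ˣ j) (recip (root (p * z)) j)) ⟩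
        X ⊛ (const (shiftCoeff z) ⊛ term (p * z) j) S.∎
        where
        D = linear w (root z 0)
        m = (- 1#) ^ suc j
        e = numerator z (suc j)
        m′ = (- 1#) ^ j
        e′ = numerator (p * z) j

        coefficients : const m ⊛ const e ≋ const (shiftCoeff z) ⊛ (const m′ ⊛ const e′)
        coefficients = S.begin
          const m ⊛ const e                               S.≈⟨ const-* m e ⟨
          const (m * e)                                   S.≈⟨ const-cong (numerator-suc z j) ⟩
          const (shiftCoeff z * (m′ * e′))                S.≈⟨ const-* (shiftCoeff z) (m′ * e′) ⟩
          const (shiftCoeff z) ⊛ const (m′ * e′)          S.≈⟨ S.*-congˡ {const (shiftCoeff z)} (const-* m′ e′) ⟩
          const (shiftCoeff z) ⊛ (const m′ ⊛ const e′)    S.∎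

      F-zero : ∀ z → w * F z 0 ≈ p
      F-zero z = begin
        w * (term z 0 0 + 0#)                    ≈⟨ *-congˡ (+-identityʳ (term z 0 0)) ⟩
        w * term z 0 0                           ≈⟨ linear-⊛-zero w (root z 0) (term z 0) ⟨
        (linear w (root z 0) ⊛ term z 0) 0       ≈⟨ term-zero z 0 ⟩
        p                                        ∎

      -- The functional equation read at x^(n+1). Multiplied by 1 - p - zxp, the summand j = 0
      -- becomes the constant p, and the summand j + 1 becomes -zp³x times summand j of F(pz).
      F-suc : ∀ z n → w * F z (suc n) ≈ shiftCoeff z * F (p * z) n + root z 0 * F z n
      F-suc z n = begin
        w * ∑[ j < suc (suc n) ] term z (toℕ j) (suc n)
          ≈⟨ *-distribˡ-sum {suc (suc n)} w (λ j → term z (toℕ j) (suc n)) ⟩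
        ∑[ j < suc (suc n) ] (w * term z (toℕ j) (suc n))
          ≈⟨ sum-cong-≋ {suc (suc n)} (λ j → linear-⊛-suc w r (term z (toℕ j)) n) ⟩
        ∑[ j < suc (suc n) ] ((linear w r ⊛ term z (toℕ j)) (suc n) + r * term z (toℕ j) n)
          ≈⟨ ∑-distrib-+ {suc (suc n)} (λ j → (linear w r ⊛ term z (toℕ j)) (suc n)) (λ j → r * term z (toℕ j) n) ⟩
        ∑[ j < suc (suc n) ] (linear w r ⊛ term z (toℕ j)) (suc n) + ∑[ j < suc (suc n) ] (r * term z (toℕ j) n)
          ≈⟨ +-cong shifted (sym (*-distribˡ-sum {suc (suc n)} r (λ j → term z (toℕ j) n))) ⟩
        shiftCoeff z * F (p * z) n + r * (∑[ j < suc (suc n) ] term z (toℕ j) n)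
          -- The sum runs up to j = n + 1, one index further than F z n does; the extra summand has
          -- no coefficient at xⁿ.
          ≈⟨ +-congˡ (*-congˡ (∑∞-converges (term z) (generalTerm-small (numerator z) (root z)) n (suc n) (ℕₚ.n≤1+n n))) ⟩
        shiftCoeff z * F (p * z) n + r * F z n ∎
        where
        r = root z 0

        shifted : ∑[ j < suc (suc n) ] (linear w r ⊛ term z (toℕ j)) (suc n) ≈ shiftCoeff z * F (p * z) n
        shifted = begin
          (linear w r ⊛ term z 0) (suc n) + ∑[ j ≤ n ] (linear w r ⊛ term z (suc (toℕ j))) (suc n)
            -- The constant p has coefficient 0 at x^(n+1).
            ≈⟨ +-cong (term-zero z (suc n)) (sum-cong-≋ {suc n} (λ j → trans
                 (term-suc z (toℕ j) (suc n))
                 (trans (X⊛-suc (const (shiftCoeff z) ⊛ term (p * z) (toℕ j)) n)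
                        (const-⊛ (shiftCoeff z) (term (p * z) (toℕ j)) n)))) ⟩
          0# + ∑[ j ≤ n ] (shiftCoeff z * term (p * z) (toℕ j) n)
            ≈⟨ +-identityˡ _ ⟩
          ∑[ j ≤ n ] (shiftCoeff z * term (p * z) (toℕ j) n)
            ≈⟨ *-distribˡ-sum {suc n} (shiftCoeff z) (λ j → term (p * z) (toℕ j) n) ⟨
          shiftCoeff z * F (p * z) n ∎

      -- Induction on n with z varying, since the recurrence for z calls on the value at pz.
      F-closed : ∀ n z → w * F z n ≈ z ^ n * areaSum (suc n)
      F-closed zero    z = begin
        w * F z 0             ≈⟨ F-zero z ⟩
        -- The factor 1 + 0 is `areaSum 0`, the contribution of the empty sequence.
        p                     ≈⟨ solve 1 (λ p → p := con 1 :* ((con 1 :+ con 0) :* (p :* con 1 :+ con 0))) refl p ⟩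
        1# * (areaSum 0 * geometric p 1) ≈⟨ *-congˡ (areaSum-suc 0) ⟨
        1# * areaSum 1        ∎
      -- The recurrence gives w·F in terms of F, while the induction hypothesis concerns w·F. One
      -- more factor w makes it applicable and is cancelled as a unit.
      F-closed (suc n) z = cancelˡ-unit wu≈1 (begin
        w * (w * F z (suc n))
          ≈⟨ *-congˡ (F-suc z n) ⟩
        w * (shiftCoeff z * F (p * z) n + z * (p * 1#) * F z n)
          ≈⟨ solve 6 (λ w s f z p g → w :* (s :* f :+ z :* (p :* con 1) :* g) := s :* (w :* f) :+ z :* p :* (w :* g)) refl
               w (shiftCoeff z) (F (p * z) n) z p (F z n) ⟩
        shiftCoeff z * (w * F (p * z) n) + z * p * (w * F z n)
          ≈⟨ +-cong (*-congˡ (trans (F-closed n (p * z)) (*-congʳ (^-distrib-* p z n)))) (*-congˡ (F-closed n z)) ⟩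
        shiftCoeff z * (p ^ n * z ^ n * W) + z * p * (z ^ n * W)
          ≈⟨ solve 6 (λ m z p pn zn W → m :* z :* (p :* (p :* (p :* con 1))) :* (pn :* zn :* W) :+ z :* p :* (zn :* W)
                                     := z :* zn :* W :* (p :+ m :* (p :* (p :* (p :* pn))))) refl
               (- 1#) z p (p ^ n) (z ^ n) W ⟩
        z ^ suc n * W * (p + - 1# * p ^ suc (suc (suc n)))
          -- p - p^(n+3) is 1 - p times p + ... + p^(n+2), the weight of the letter at position n +
          -- 2.
          ≈⟨ *-congˡ (geometric-closed p (suc (suc n))) ⟨
        z ^ suc n * W * (w * geometric p (suc (suc n)))
          ≈⟨ solve 4 (λ z W w g → z :* W :* (w :* g) := w :* (z :* (W :* g))) refl (z ^ suc n) W w (geometric p (suc (suc n))) ⟩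
        w * (z ^ suc n * (W * geometric p (suc (suc n))))
          ≈⟨ *-congˡ (*-congˡ (areaSum-suc (suc n))) ⟨
        w * (z ^ suc n * areaSum (suc (suc n))) ∎)
        where W = areaSum (suc n)

      -- With t = yp, the closed forms at z = 1 and z = t differ by the factor tⁿ, and the prefactor
      -- y²p² = t² raises it to t^(n+2). What remains is t - t^(n+3), a geometric sum times 1 - t,
      -- which v cancels.
      F-combination : ∀ y v → (1# - y * p) * v ≈ 1# → ∀ n →
        y * p * w * v * (F 1# n - y ^ 2 * p ^ 2 * F (y * p) n) ≈ areaSum (suc n) * geometric (y * p) (suc (suc n))
      F-combination y v sv≈1 n = begin
        t * w * v * (F 1# n - y ^ 2 * p ^ 2 * F t n)
          ≈⟨ *-congˡ (+-congˡ (-1*x≈-x _)) ⟨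
        t * w * v * (F 1# n + - 1# * (y ^ 2 * p ^ 2 * F t n))
          ≈⟨ solve 7 (λ t w v f m q g → t :* w :* v :* (f :+ m :* (q :* g)) := v :* t :* (w :* f :+ m :* (q :* (w :* g)))) refl
               t w v (F 1# n) (- 1#) (y ^ 2 * p ^ 2) (F t n) ⟩
        v * t * (w * F 1# n + - 1# * (y ^ 2 * p ^ 2 * (w * F t n)))
          ≈⟨ *-congˡ (+-cong (trans (F-closed n 1#) (*-congʳ (1^n≈1 n))) (*-congˡ (*-congˡ (F-closed n t)))) ⟩
        v * t * (1# * W + - 1# * (y ^ 2 * p ^ 2 * (t ^ n * W)))
          ≈⟨ solve 6 (λ v y p m tn W → v :* (y :* p) :* (con 1 :* W :+ m :* (y :* (y :* con 1) :* (p :* (p :* con 1)) :* (tn :* W)))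
                                     := v :* W :* (y :* p :+ m :* (y :* p :* (y :* p :* (y :* p :* tn))))) refl
               v y p (- 1#) (t ^ n) W ⟩
        v * W * (t + - 1# * t ^ suc (suc (suc n)))
          ≈⟨ *-congˡ (geometric-closed t (suc (suc n))) ⟨
        v * W * ((1# - t) * geometric t (suc (suc n)))
          ≈⟨ solve 4 (λ v W s g → v :* W :* (s :* g) := s :* v :* (W :* g)) refl v W (1# - t) (geometric t (suc (suc n))) ⟩
        (1# - t) * v * (W * geometric t (suc (suc n)))
          ≈⟨ trans (*-congʳ sv≈1) (*-identityˡ _) ⟩
        W * geometric t (suc (suc n)) ∎
        where
        t = y * p
        W = areaSum (suc n)

  -- Assembly of the generating function A

  X²⊛-suc-suc : ∀ f n → (X ^ˣ 2 ⊛ f) (suc (suc n)) ≈ f n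
  X²⊛-suc-suc f n = begin
    (X ^ˣ 2 ⊛ f) (suc (suc n))        ≈⟨ S.trans (S.*-congʳ {f} (S.*-congˡ {X} (S.*-identityʳ X))) (S.*-assoc X X f) (suc (suc n)) ⟩
    (X ⊛ (X ⊛ f)) (suc (suc n))       ≈⟨ X⊛-suc (X ⊛ f) (suc n) ⟩
    (X ⊛ f) (suc n)                   ≈⟨ X⊛-suc f n ⟩
    f n                               ∎

  -- Compared coefficientwise. The factor x² matches coefficient n of the bracket with length n + 2;
  -- lengths 0 and 1 are covered by the term xyp alone.
  A-from-F : ∀ p y u v → (wu≈1 : (1# - p) * u ≈ 1#) → (1# - y * p) * v ≈ 1# →
    A y p 1# ≋ X ⊛ const (y * p) ⊕ X ^ˣ 2 ⊛ const (y * p * (1# - p) * v)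
                  ⊛ (F p u wu≈1 1# ⊖ const (y ^ 2 * p ^ 2) ⊛ F p u wu≈1 (y * p))
  A-from-F p y u v wu≈1 sv≈1 n = sym (trans (+-congˡ (⊛-assoc (X ^ˣ 2) (const b) G n)) (coefficient n))
    where
    b = y * p * (1# - p) * v
    G = F p u wu≈1 1# ⊖ const (y ^ 2 * p ^ 2) ⊛ F p u wu≈1 (y * p)

    coefficient : (X ⊛ const (y * p) ⊕ X ^ˣ 2 ⊛ (const b ⊛ G)) ≋ A y p 1#
    coefficient zero = begin
      (X ⊛ const (y * p)) 0 + (X ^ˣ 2 ⊛ (const b ⊛ G)) 0
        ≈⟨ +-cong (X⊛-zero (const (y * p))) (X^⊛-small (const b ⊛ G) 2 0 (s≤s ℕ.z≤n)) ⟩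
      0# + 0#  ≈⟨ +-identityˡ 0# ⟩
      0#       ∎
    coefficient (suc zero) = begin
      (X ⊛ const (y * p)) 1 + (X ^ˣ 2 ⊛ (const b ⊛ G)) 1
        ≈⟨ +-cong (X⊛-suc (const (y * p)) 0) (X^⊛-small (const b ⊛ G) 2 1 (s≤s (s≤s ℕ.z≤n))) ⟩
      y * p + 0#
        ≈⟨ solve 1 (λ t → t :+ con 0 := (con 1 :+ con 0) :* (t :* con 1 :+ con 0)) refl (y * p) ⟩
      areaSum p 0 * geometric (y * p) 1
        ≈⟨ a-closed p y 0 ⟨
      a 1 y p 1# ∎
    coefficient (suc (suc n)) = begin
      (X ⊛ const (y * p)) (suc (suc n)) + (X ^ˣ 2 ⊛ (const b ⊛ G)) (suc (suc n))
        ≈⟨ +-cong (X⊛-suc (const (y * p)) (suc n)) (X²⊛-suc-suc (const b ⊛ G) n) ⟩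
      0# + (const b ⊛ G) n
        ≈⟨ trans (+-identityˡ _) (const-⊛ b G n) ⟩
      b * G n
        ≈⟨ *-congˡ (+-congˡ (-‿cong (const-⊛ (y ^ 2 * p ^ 2) (F p u wu≈1 (y * p)) n))) ⟩
      b * (F p u wu≈1 1# n - y ^ 2 * p ^ 2 * F p u wu≈1 (y * p) n)
        ≈⟨ F-combination p u wu≈1 y v sv≈1 n ⟩
      areaSum p (suc n) * geometric (y * p) (suc (suc n))
        ≈⟨ a-closed p y (suc n) ⟨
      a (suc (suc n)) y p 1# ∎

theorem2p7 : ∀ {c ℓ} (R : CommutativeRing c ℓ) →
    let open CommutativeRing R
        open PowerSeries R
    in
    -- u = 1/(1-p), v = 1/(1-yp); both products below have constant term (1-p)^(j+1)
    (p y u v : Carrier) → (1# - p) * u ≈ 1# → (1# - y * p) * v ≈ 1# →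
    A y p 1# ≋
      X ⊛ const (y * p)
      ⊕ X ^ˣ 2 ⊛ const (y * p * (1# - p) * v)
        ⊛ ( (∑∞[ j ] (const ((- 1#) ^ j) ⊛ X ^ˣ j ⊛ const (p ^ (j ℕ.+ ((j ℕ.+ 2) C 2)))
                      ⊛ inverse (∏[ i ≤ j ] (const (1# - p) ⊖ X ⊛ const (p ^ (i ℕ.+ 1)))) (u ^ suc j)))
          ⊖ const (y ^ 2 * p ^ 2)
            ⊛ (∑∞[ j ] (const ((- 1#) ^ j) ⊛ X ^ˣ j ⊛ const (y ^ j * p ^ (2 ℕ.* j ℕ.+ ((j ℕ.+ 2) C 2)))
                        ⊛ inverse (∏[ i ≤ j ] (const (1# - p) ⊖ X ⊛ const (y * p ^ (i ℕ.+ 2)))) (u ^ suc j))))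
theorem2p7 R p y u v wu≈1 sv≈1 n = trans (A-from-F R p y u v wu≈1 sv≈1 n)
  -- It remains to rewrite the summands: at z = 1 the powers of z disappear, and at z = yp its
  -- powers of p merge with the others.
  (+-congˡ (⊛-cong R {f = X ^ˣ 2 ⊛ const (y * p * (1# - p) * v)} (λ _ → refl) (λ k → +-cong
    (∑∞-cong R (generalTerm-cong R p u wu≈1
      (numerator-one R p) (λ i → *-identityˡ (p ^ (i ℕ.+ 1)))) k)
    (-‿cong (⊛-cong R {f = const (y ^ 2 * p ^ 2)} (λ _ → refl)
      (∑∞-cong R (generalTerm-cong R p u wu≈1
        (numerator-yp R p y) (root-yp R p y))) k))) n))
  where
  open CommutativeRing R
  open PowerSeries R
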